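{- Let $n,k$ be positive integers and let $\mathscr{K}_{n,k}$ be the family of all graphs with at most $n$ vertices that are disjoint unions of cliques, each clique having at most $k$ vertices. Then \[ \mathscr{U}(\mathscr{K}_{n,k}) ~=~ \sum_{i=1}^k \left\lfloor \frac{n}{i} \right\rfloor ~\ge~ (n+1)\ln(k+1) - k . \]
   Context: All graphs are finite and simple. A graph $U$ is an induced-universal graph for a family $\mathscr{F}$ of graphs if every graph of $\mathscr{F}$ is isomorphic to an induced subgraph of $U$. $\mathscr{U}(\mathscr{F})$ denotes the smallest number of vertices of an induced-universal graph for $\mathscr{F}$. -}

module Defs where

open import Data.Fin.Base using (Fin)
import Data.Fin.Properties as Fin
open import Data.Fin.Subset using (Subset; _∈_)
open import Data.Integer.Base as ℤ using (+_)
import Data.Integer.Properties as ℤ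
open import Data.List.Base using (applyUpTo)
open import Data.Nat.Base as ℕ using (ℕ; zero; suc)
import Data.Nat.Properties as ℕ
open import Data.Nat.ListAction using (sum)
open import Data.Product.Base using (Σ; Σ-syntax; ∃; ∃-syntax; _×_; _,_; proj₁; proj₂)
open import Data.Rational.Base as ℚ using (ℚ; 0ℚ; 1ℚ; ½; _+_; _-_; -_; _*_; _/_; 1/_; ∣_∣;
  _≤_; _<_; Positive)
import Data.Rational.Properties as ℚ
open import Data.Rational.Solver using (module +-*-Solver)
import Data.Rational.Unnormalised.Base as ℚᵘ
import Data.Rational.Unnormalised.Properties as ℚᵘ
open import Data.Sum.Base using (inj₁; inj₂)
open import Function.Base using (_∘_)
open import Function.Bundles using (_↔_; _⇔_; Inverse)
open import Level using (0ℓ)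
open import Relation.Binary.Core using (Rel)
open import Relation.Binary.Definitions using (Symmetric; Irreflexive; Decidable)
open import Relation.Binary.PropositionalEquality.Core
  using (_≡_; _≢_; refl; sym; trans; cong; cong₂; subst; ≢-sym)
open import Relation.Nullary.Decidable using (yes; no; ¬?)

------------------------------------------------------------------------
-- Graphs

record SimpleGraph (V : Set) : Set₁ where
  field
    Adj     : Rel V 0ℓ
    adj?    : Decidable Adj
    sym-adj : Symmetric Adj
    irrefl  : Irreflexive _≡_ Adj

open SimpleGraph public

infix 4 _≅_

record _≅_ {V W : Set} (G : SimpleGraph V) (H : SimpleGraph W) : Set where
  field
    vertices : V ↔ W
    adj⇔     : ∀ x y → Adj G x y ⇔ Adj H (Inverse.to vertices x) (Inverse.to vertices y)

induced : ∀ {N} → SimpleGraph (Fin N) → (S : Subset N) → SimpleGraph (∃[ v ] v ∈ S)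
induced U S = record
  { Adj     = λ x y → Adj U (proj₁ x) (proj₁ y)
  ; adj?    = λ x y → adj? U (proj₁ x) (proj₁ y)
  ; sym-adj = sym-adj U
  ; irrefl  = λ x≡y → irrefl U (cong proj₁ x≡y)
  }

complete : ∀ a → SimpleGraph (Fin a)
complete a = record
  { Adj     = _≢_
  ; adj?    = λ x y → ¬? (x Fin.≟ y)
  ; sym-adj = ≢-sym
  ; irrefl  = λ x≡y x≢y → x≢y x≡y
  }

data ⨆-Adj {r} {V : Fin r → Set} (G : ∀ i → SimpleGraph (V i)) : Rel (Σ (Fin r) V) 0ℓ where
  within : ∀ {i x y} → Adj (G i) x y → ⨆-Adj G (i , x) (i , y)

⨆ : ∀ {r} {V : Fin r → Set} → (∀ i → SimpleGraph (V i)) → SimpleGraph (Σ (Fin r) V)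
⨆ {r} {V} G = record
  { Adj     = ⨆-Adj G
  ; adj?    = dec
  ; sym-adj = λ { (within e) → within (sym-adj (G _) e) }
  ; irrefl  = λ { refl (within e) → irrefl (G _) refl e }
  }
  where
  dec : Decidable (⨆-Adj G)
  dec (i , x) (j , y) with i Fin.≟ j
  ... | no  i≢j  = no λ { (within _) → i≢j refl }
  ... | yes refl with adj? (G i) x y
  ...   | yes e = yes (within e)
  ...   | no ¬e = no λ { (within e) → ¬e e }

-- Every finite graph is isomorphic to one whose vertex set is some Fin m, so
-- a family of finite graphs is given by its members of this form.
GraphFamily : Set₁
GraphFamily = ∀ m → SimpleGraph (Fin m) → Set

IsInducedUniversal : ∀ {N} → GraphFamily → SimpleGraph (Fin N) → Set₁
IsInducedUniversal {N} 𝓕 U =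
  ∀ m (G : SimpleGraph (Fin m)) → 𝓕 m G → Σ[ S ∈ Subset N ] G ≅ induced U S

-- 𝒰 𝓕 ≔ N reads "the smallest number of vertices of an induced-universal
-- graph for 𝓕 is N".
infix 4 𝒰_≔_

record 𝒰_≔_ (𝓕 : GraphFamily) (N : ℕ) : Set₁ where
  field
    attained : Σ[ U ∈ SimpleGraph (Fin N) ] IsInducedUniversal 𝓕 U
    minimal  : ∀ M (U : SimpleGraph (Fin M)) → IsInducedUniversal 𝓕 U → N ℕ.≤ M

𝒦 : ℕ → ℕ → GraphFamily
𝒦 n k m G =
  m ℕ.≤ n ×
  Σ[ r ∈ ℕ ] Σ[ a ∈ (Fin r → ℕ) ] (∀ i → a i ℕ.≤ k) × G ≅ ⨆ (λ i → complete (a i))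

-- ∑⌊ n / i ⌋ over 1 ≤ i ≤ k.
floorSum : ℕ → ℕ → ℕ
floorSum n k = sum (applyUpTo (λ i → n ℕ./ suc i) k)

------------------------------------------------------------------------
-- Real numbers, as Cauchy sequences of rationals

IsCauchy : (ℕ → ℚ) → Set
IsCauchy x = ∀ ε → 0ℚ < ε →
  ∃[ N ] ∀ m n → N ℕ.≤ m → N ℕ.≤ n → ∣ x m - x n ∣ < ε

record ℝ : Set where
  constructor mkℝ
  field
    seq    : ℕ → ℚ
    cauchy : IsCauchy seq

open ℝ public

infix 4 _≤ᴿ_ _≥ᴿ_

_≤ᴿ_ : ℝ → ℝ → Set
x ≤ᴿ y = ∀ ε → 0ℚ < ε → ∃[ N ] ∀ m → N ℕ.≤ m → seq x m ≤ seq y m + ε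

_≥ᴿ_ : ℝ → ℝ → Set
x ≥ᴿ y = y ≤ᴿ x

fromℚ : ℚ → ℝ
fromℚ q = mkℝ (λ _ → q) λ ε 0<ε → 0 , λ _ _ _ _ →
  subst (_< ε) (sym (cong ∣_∣ (ℚ.+-inverseʳ q))) 0<ε

fromℕ : ℕ → ℝ
fromℕ n = fromℚ (+ n / 1)

infixl 6 _-ᴿ_
infixl 7 _·ᴿ_

_-ᴿ_ : ℝ → ℝ → ℝ
x -ᴿ y = mkℝ (λ m → seq x m - seq y m) cau
  where
  open +-*-Solver
  cau : IsCauchy (λ m → seq x m - seq y m)
  cau ε 0<ε = Nx ℕ.⊔ Ny , bound
    where
    δ = ½ * ε
    0<δ : 0ℚ < δ
    0<δ = subst (_< δ) (ℚ.*-zeroʳ ½) (ℚ.*-monoʳ-<-pos ½ 0<ε)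
    Nx = proj₁ (cauchy x δ 0<δ)
    Ny = proj₁ (cauchy y δ 0<δ)
    regroup : ∀ a b c d → (a - b) - (c - d) ≡ (a - c) - (b - d)
    regroup = solve 4 (λ a b c d → (a :- b) :- (c :- d) := (a :- c) :- (b :- d)) refl
    halves : δ + δ ≡ ε
    halves = trans (sym (ℚ.*-distribʳ-+ ε ½ ½)) (ℚ.*-identityˡ ε)
    bound : ∀ m n → Nx ℕ.⊔ Ny ℕ.≤ m → Nx ℕ.⊔ Ny ℕ.≤ n →
            ∣ (seq x m - seq y m) - (seq x n - seq y n) ∣ < ε
    bound m n N≤m N≤n = begin-strict
      ∣ (seq x m - seq y m) - (seq x n - seq y n) ∣
        ≡⟨ cong ∣_∣ (regroup (seq x m) (seq y m) (seq x n) (seq y n)) ⟩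
      ∣ (seq x m - seq x n) - (seq y m - seq y n) ∣
        ≤⟨ ℚ.∣p-q∣≤∣p∣+∣q∣ (seq x m - seq x n) (seq y m - seq y n) ⟩
      ∣ seq x m - seq x n ∣ + ∣ seq y m - seq y n ∣
        <⟨ ℚ.+-mono-<
             (proj₂ (cauchy x δ 0<δ) m n (ℕ.m⊔n≤o⇒m≤o Nx Ny N≤m) (ℕ.m⊔n≤o⇒m≤o Nx Ny N≤n))
             (proj₂ (cauchy y δ 0<δ) m n (ℕ.m⊔n≤o⇒n≤o Nx Ny N≤m) (ℕ.m⊔n≤o⇒n≤o Nx Ny N≤n)) ⟩
      δ + δ ≡⟨ halves ⟩
      ε ∎
      where open ℚ.≤-Reasoning

_·ᴿ_ : ℚ → ℝ → ℝ
q ·ᴿ x = mkℝ (λ m → q * seq x m) cau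
  where
  open +-*-Solver
  c = ∣ q ∣ + 1ℚ
  instance
    c-pos : Positive c
    c-pos = ℚ.nonNeg+pos⇒pos ∣ q ∣ {{ℚ.∣-∣-nonNeg q}} 1ℚ
    c≢0 : ℚ.NonZero c
    c≢0 = ℚ.pos⇒nonZero c
  cau : IsCauchy (λ m → q * seq x m)
  cau ε 0<ε = N , bound
    where
    δ = 1/ c * ε
    0<δ : 0ℚ < δ
    0<δ = subst (_< δ) (ℚ.*-zeroʳ (1/ c)) (ℚ.*-monoʳ-<-pos (1/ c) {{ℚ.1/pos⇒pos c}} 0<ε)
    N = proj₁ (cauchy x δ 0<δ)
    factor : ∀ a b → q * a - q * b ≡ q * (a - b)
    factor = solve 3 (λ q a b → q :* a :- q :* b := q :* (a :- b)) refl q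
    bound : ∀ m n → N ℕ.≤ m → N ℕ.≤ n → ∣ q * seq x m - q * seq x n ∣ < ε
    bound m n N≤m N≤n = begin-strict
      ∣ q * seq x m - q * seq x n ∣  ≡⟨ cong ∣_∣ (factor (seq x m) (seq x n)) ⟩
      ∣ q * d ∣                      ≡⟨ ℚ.∣p*q∣≡∣p∣*∣q∣ q d ⟩
      ∣ q ∣ * ∣ d ∣                  ≤⟨ ℚ.*-monoʳ-≤-nonNeg ∣ d ∣ {{ℚ.∣-∣-nonNeg d}} ∣q∣≤c ⟩
      c * ∣ d ∣                      <⟨ ℚ.*-monoʳ-<-pos c (proj₂ (cauchy x δ 0<δ) m n N≤m N≤n) ⟩
      c * δ                          ≡⟨ sym (ℚ.*-assoc c (1/ c) ε) ⟩
      c * 1/ c * ε                   ≡⟨ cong (_* ε) (ℚ.*-inverseʳ c) ⟩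
      1ℚ * ε                         ≡⟨ ℚ.*-identityˡ ε ⟩
      ε ∎
      where
      open ℚ.≤-Reasoning
      d = seq x m - seq x n
      ∣q∣≤c : ∣ q ∣ ≤ c
      ∣q∣≤c = subst (_≤ c) (ℚ.+-identityʳ ∣ q ∣)
        (ℚ.+-monoʳ-≤ ∣ q ∣ (ℚ.nonNegative⁻¹ 1ℚ))

------------------------------------------------------------------------
-- The natural logarithm of a positive integer

∑< : ℕ → (ℕ → ℚ) → ℚ
∑< zero    f = 0ℚ
∑< (suc N) f = ∑< N f + f N

∑<-cong : ∀ N {f g} → (∀ i → f i ≡ g i) → ∑< N f ≡ ∑< N g
∑<-cong zero    f≡g = refl
∑<-cong (suc N) f≡g = cong₂ _+_ (∑<-cong N f≡g) (f≡g N)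

∑<-mono : ∀ N {f g} → (∀ i → i ℕ.< N → f i ≤ g i) → ∑< N f ≤ ∑< N g
∑<-mono zero    f≤g = ℚ.≤-refl
∑<-mono (suc N) f≤g =
  ℚ.+-mono-≤ (∑<-mono N (λ i i<N → f≤g i (ℕ.m<n⇒m<1+n i<N))) (f≤g N (ℕ.n<1+n N))

∑<-shift : ∀ N f → ∑< N f + f N ≡ f 0 + ∑< N (f ∘ suc)
∑<-shift zero    f = ℚ.+-comm 0ℚ (f 0)
∑<-shift (suc N) f =
  trans (cong (_+ f (suc N)) (∑<-shift N f)) (ℚ.+-assoc (f 0) (∑< N (f ∘ suc)) (f (suc N)))

∑<-+ : ∀ M N f → ∑< (M ℕ.+ N) f ≡ ∑< M f + ∑< N (λ i → f (M ℕ.+ i))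
∑<-+ M zero    f rewrite ℕ.+-identityʳ M = sym (ℚ.+-identityʳ (∑< M f))
∑<-+ M (suc N) f rewrite ℕ.+-suc M N =
  trans (cong (_+ f (M ℕ.+ N)) (∑<-+ M N f)) (ℚ.+-assoc (∑< M f) _ (f (M ℕ.+ N)))

∑<-blocks : ∀ N q f → ∑< (N ℕ.* q) f ≡ ∑< N (λ i → ∑< q (λ j → f (i ℕ.* q ℕ.+ j)))
∑<-blocks zero    q f = refl
∑<-blocks (suc N) q f rewrite ℕ.+-comm q (N ℕ.* q) =
  trans (∑<-+ (N ℕ.* q) q f) (cong (_+ ∑< q (λ j → f (N ℕ.* q ℕ.+ j))) (∑<-blocks N q f))

∑<-const : ∀ N c → ∑< N (λ _ → c) ≡ + N / 1 * c
∑<-const zero    c = sym (ℚ.*-zeroˡ c)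
∑<-const (suc N) c = trans (cong (_+ c) (∑<-const N c)) (trans (step (+ N / 1)) (cong (_* c) 1+N))
  where
  open +-*-Solver
  step : ∀ a → a * c + c ≡ (1ℚ + a) * c
  step a = solve 2 (λ a c → a :* c :+ c := (con 1ℚ :+ a) :* c) refl a c
  1+N : 1ℚ + + N / 1 ≡ + suc N / 1
  1+N = ℚ.toℚᵘ-injective (ℚᵘ.≃-trans (ℚ.toℚᵘ-homo-+ 1ℚ (+ N / 1))
    (ℚᵘ.≃-trans (ℚᵘ.+-congʳ ℚᵘ.1ℚᵘ (ℚ.toℚᵘ-fromℚᵘ (ℚᵘ.mkℚᵘ (+ N) 0)))
    (ℚᵘ.≃-trans (ℚᵘ.*≡* (cong (λ z → (+ 1 ℤ.+ z) ℤ.* + 1) (ℤ.*-identityʳ (+ N))))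
    (ℚᵘ.≃-sym (ℚ.toℚᵘ-fromℚᵘ (ℚᵘ.mkℚᵘ (+ suc N) 0))))))

-- recip d = 1/(d+1)
recip : ℕ → ℚ
recip d = + 1 / suc d

recip-anti : ∀ {d e} → d ℕ.≤ e → recip e ≤ recip d
recip-anti {d} {e} d≤e = ℚ.toℚᵘ-cancel-≤
  (ℚᵘ.≤-respˡ-≃ (ℚᵘ.≃-sym (ℚ.toℚᵘ-fromℚᵘ (ℚᵘ.mkℚᵘ (+ 1) e)))
  (ℚᵘ.≤-respʳ-≃ (ℚᵘ.≃-sym (ℚ.toℚᵘ-fromℚᵘ (ℚᵘ.mkℚᵘ (+ 1) d)))
  (ℚᵘ.*≤* (ℤ.*-monoˡ-≤-nonNeg (+ 1) (ℤ.+≤+ (ℕ.s≤s d≤e))))))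

-- (q+1) · 1/((d+1)(q+1)) = 1/(d+1)
recip-* : ∀ q d → + suc q / 1 * recip (q ℕ.+ d ℕ.* suc q) ≡ recip d
recip-* q d = ℚ.toℚᵘ-injective (ℚᵘ.≃-trans (ℚ.toℚᵘ-homo-* (+ suc q / 1) (recip e))
  (ℚᵘ.≃-trans (ℚᵘ.*-cong (ℚ.toℚᵘ-fromℚᵘ (ℚᵘ.mkℚᵘ (+ suc q) 0)) (ℚ.toℚᵘ-fromℚᵘ (ℚᵘ.mkℚᵘ (+ 1) e)))
  (ℚᵘ.≃-trans (ℚᵘ.*≡* (cong +_ eq)) (ℚᵘ.≃-sym (ℚ.toℚᵘ-fromℚᵘ (ℚᵘ.mkℚᵘ (+ 1) d))))))
  where
  e = q ℕ.+ d ℕ.* suc q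
  eq : suc q ℕ.* 1 ℕ.* suc d ≡ 1 ℕ.* (1 ℕ.* suc e)
  eq rewrite ℕ.*-identityʳ q | ℕ.+-identityʳ e | ℕ.+-identityʳ e = ℕ.*-comm (suc q) (suc d)

recip-nonNeg : ∀ d → 0ℚ ≤ recip d
recip-nonNeg d = ℚ.nonNegative⁻¹ (recip d) {{ℚ.normalize-nonNeg 1 (suc d)}}

-- Right-endpoint Riemann sum of ∫₁^{k+1} dt/t for the partition of mesh 1/m:
-- ∑_{j<km} (1/m) · 1/(1 + (j+1)/m) = ∑_{j<km} 1/(m+j+1).  (Empty for m = 0.)
lower : ℕ → ℕ → ℚ
lower k m = ∑< (k ℕ.* m) (λ j → + 1 / suc (m ℕ.+ j))

-- Left-endpoint Riemann sum for the partition of mesh 1/(m+1).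
upper : ℕ → ℕ → ℚ
upper k m = ∑< (k ℕ.* suc m) (λ j → + 1 / suc (m ℕ.+ j))

lower≤upper : ∀ k m → lower k (suc m) ≤ upper k m
lower≤upper k m = ∑<-mono (k ℕ.* suc m) (λ i _ → recip-anti (ℕ.n≤1+n (m ℕ.+ i)))

upper≤lower+mesh : ∀ k m → upper k m ≤ recip m + lower k (suc m)
upper≤lower+mesh k m = begin
  ∑< N f                  ≡⟨ sym (ℚ.+-identityʳ (∑< N f)) ⟩
  ∑< N f + 0ℚ             ≤⟨ ℚ.+-monoʳ-≤ (∑< N f) (recip-nonNeg (m ℕ.+ N)) ⟩
  ∑< N f + f N            ≡⟨ ∑<-shift N f ⟩
  f 0 + ∑< N (f ∘ suc)    ≡⟨ cong₂ _+_ (cong recip (ℕ.+-identityʳ m))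
                               (∑<-cong N (λ i → cong recip (ℕ.+-suc m i))) ⟩
  recip m + lower k (suc m) ∎
  where
  open ℚ.≤-Reasoning
  N = k ℕ.* suc m
  f : ℕ → ℚ
  f j = recip (m ℕ.+ j)

lower-refine : ∀ k m q → lower k m ≤ lower k (m ℕ.* suc q)
lower-refine k m q = begin
  ∑< (k ℕ.* m) (λ i → recip (m ℕ.+ i))
    ≤⟨ ∑<-mono (k ℕ.* m) (λ i _ → block i) ⟩
  ∑< (k ℕ.* m) (λ i → ∑< (suc q) (λ j → f (i ℕ.* suc q ℕ.+ j)))
    ≡⟨ sym (∑<-blocks (k ℕ.* m) (suc q) f) ⟩
  ∑< (k ℕ.* m ℕ.* suc q) f
    ≡⟨ cong (λ N → ∑< N f) (ℕ.*-assoc k m (suc q)) ⟩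
  lower k (m ℕ.* suc q) ∎
  where
  open ℚ.≤-Reasoning
  f : ℕ → ℚ
  f j = recip (m ℕ.* suc q ℕ.+ j)
  index : ∀ i j → j ℕ.< suc q →
          m ℕ.* suc q ℕ.+ (i ℕ.* suc q ℕ.+ j) ℕ.≤ q ℕ.+ (m ℕ.+ i) ℕ.* suc q
  index i j j<q rewrite ℕ.*-distribʳ-+ (suc q) m i
                      | sym (ℕ.+-assoc (m ℕ.* suc q) (i ℕ.* suc q) j)
                      | ℕ.+-comm q (m ℕ.* suc q ℕ.+ i ℕ.* suc q)
    = ℕ.+-monoʳ-≤ (m ℕ.* suc q ℕ.+ i ℕ.* suc q) (ℕ.s≤s⁻¹ j<q)
  block : ∀ i → recip (m ℕ.+ i) ≤ ∑< (suc q) (λ j → f (i ℕ.* suc q ℕ.+ j))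
  block i = begin
    recip (m ℕ.+ i)                  ≡⟨ sym (recip-* q (m ℕ.+ i)) ⟩
    + suc q / 1 * recip e            ≡⟨ sym (∑<-const (suc q) (recip e)) ⟩
    ∑< (suc q) (λ _ → recip e)       ≤⟨ ∑<-mono (suc q) (λ j j<q → recip-anti (index i j j<q)) ⟩
    ∑< (suc q) (λ j → f (i ℕ.* suc q ℕ.+ j)) ∎
    where e = q ℕ.+ (m ℕ.+ i) ℕ.* suc q

-- Here q + m(q+1) = (m+1)(q+1) − 1, i.e. the mesh passes from 1/(m+1) to
-- 1/((m+1)(q+1)).
upper-refine : ∀ k m q → upper k (q ℕ.+ m ℕ.* suc q) ≤ upper k m
upper-refine k m q = begin
  upper k (q ℕ.+ m ℕ.* suc q)
    ≡⟨ cong (λ N → ∑< N f) (sym (ℕ.*-assoc k (suc m) (suc q))) ⟩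
  ∑< (k ℕ.* suc m ℕ.* suc q) f
    ≡⟨ ∑<-blocks (k ℕ.* suc m) (suc q) f ⟩
  ∑< (k ℕ.* suc m) (λ i → ∑< (suc q) (λ j → f (i ℕ.* suc q ℕ.+ j)))
    ≤⟨ ∑<-mono (k ℕ.* suc m) (λ i _ → block i) ⟩
  upper k m ∎
  where
  open ℚ.≤-Reasoning
  f : ℕ → ℚ
  f j = recip (q ℕ.+ m ℕ.* suc q ℕ.+ j)
  index : ∀ i j →
          q ℕ.+ (m ℕ.+ i) ℕ.* suc q ℕ.≤ q ℕ.+ m ℕ.* suc q ℕ.+ (i ℕ.* suc q ℕ.+ j)
  index i j rewrite ℕ.*-distribʳ-+ (suc q) m i
                  | sym (ℕ.+-assoc q (m ℕ.* suc q) (i ℕ.* suc q))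
                  | sym (ℕ.+-assoc (q ℕ.+ m ℕ.* suc q) (i ℕ.* suc q) j)
    = ℕ.m≤m+n _ j
  block : ∀ i → ∑< (suc q) (λ j → f (i ℕ.* suc q ℕ.+ j)) ≤ recip (m ℕ.+ i)
  block i = begin
    ∑< (suc q) (λ j → f (i ℕ.* suc q ℕ.+ j)) ≤⟨ ∑<-mono (suc q) (λ j _ → recip-anti (index i j)) ⟩
    ∑< (suc q) (λ _ → recip e)               ≡⟨ ∑<-const (suc q) (recip e) ⟩
    + suc q / 1 * recip e                    ≡⟨ recip-* q (m ℕ.+ i) ⟩
    recip (m ℕ.+ i) ∎
    where e = q ℕ.+ (m ℕ.+ i) ℕ.* suc q

lower≤upper′ : ∀ k m n → lower k (suc m) ≤ upper k n
lower≤upper′ k m n = begin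
  lower k (suc m)                 ≤⟨ lower-refine k (suc m) n ⟩
  lower k (suc m ℕ.* suc n)       ≡⟨ cong (lower k) (ℕ.*-comm (suc m) (suc n)) ⟩
  lower k (suc (m ℕ.+ n ℕ.* suc m)) ≤⟨ lower≤upper k (m ℕ.+ n ℕ.* suc m) ⟩
  upper k (m ℕ.+ n ℕ.* suc m)     ≤⟨ upper-refine k n m ⟩
  upper k n ∎
  where open ℚ.≤-Reasoning

lower-difference : ∀ k m n → lower k (suc m) - lower k (suc n) ≤ recip n
lower-difference k m n = begin
  lower k (suc m) - l    ≤⟨ ℚ.+-monoˡ-≤ (- l) (lower≤upper′ k m n) ⟩
  upper k n - l          ≤⟨ ℚ.+-monoˡ-≤ (- l) (upper≤lower+mesh k n) ⟩
  recip n + l - l        ≡⟨ cancel (recip n) l ⟩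
  recip n ∎
  where
  open ℚ.≤-Reasoning
  open +-*-Solver
  l = lower k (suc n)
  cancel : ∀ a b → a + b - b ≡ a
  cancel = solve 2 (λ a b → a :+ b :- b := a) refl

archimedean : ∀ ε → 0ℚ < ε → ∃[ N ] recip N < ε
archimedean ε@(ℚ.mkℚ (+ suc p) d _) 0<ε = suc d ,
  ℚ.toℚᵘ-cancel-< (ℚᵘ.<-respˡ-≃ (ℚᵘ.≃-sym (ℚ.toℚᵘ-fromℚᵘ (ℚᵘ.mkℚᵘ (+ 1) (suc d))))
    (ℚᵘ.*<* (ℤ.+<+ bound)))
  where
  bound : 1 ℕ.* suc d ℕ.< suc p ℕ.* suc (suc d)
  bound = ℕ.≤-trans (ℕ.s≤s (ℕ.≤-reflexive (ℕ.*-identityˡ (suc d)))) (ℕ.m≤n*m (suc (suc d)) (suc p))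
archimedean (ℚ.mkℚ (+ zero) d _) (ℚ.*<* (ℤ.+<+ ()))
archimedean (ℚ.mkℚ (ℤ.-[1+ p ]) d _) (ℚ.*<* ())

lower-cauchy : ∀ k → IsCauchy (lower k)
lower-cauchy k ε 0<ε = suc N , bound
  where
  N = proj₁ (archimedean ε 0<ε)
  bound : ∀ m n → suc N ℕ.≤ m → suc N ℕ.≤ n → ∣ lower k m - lower k n ∣ < ε
  bound (suc m) (suc n) (ℕ.s≤s N≤m) (ℕ.s≤s N≤n)
    with ℚ.∣p∣≡p∨∣p∣≡-p (lower k (suc m) - lower k (suc n))
  ... | inj₁ eq = begin-strict
    ∣ lower k (suc m) - lower k (suc n) ∣  ≡⟨ eq ⟩
    lower k (suc m) - lower k (suc n)      ≤⟨ lower-difference k m n ⟩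
    recip n                                ≤⟨ recip-anti N≤n ⟩
    recip N                                <⟨ proj₂ (archimedean ε 0<ε) ⟩
    ε ∎
    where open ℚ.≤-Reasoning
  ... | inj₂ eq = begin-strict
    ∣ lower k (suc m) - lower k (suc n) ∣  ≡⟨ eq ⟩
    - (lower k (suc m) - lower k (suc n))  ≡⟨ flip (lower k (suc m)) (lower k (suc n)) ⟩
    lower k (suc n) - lower k (suc m)      ≤⟨ lower-difference k n m ⟩
    recip m                                ≤⟨ recip-anti N≤m ⟩
    recip N                                <⟨ proj₂ (archimedean ε 0<ε) ⟩
    ε ∎
    where
    open ℚ.≤-Reasoning
    open +-*-Solver
    flip : ∀ a b → - (a - b) ≡ b - a
    flip = solve 2 (λ a b → :- (a :- b) := b :- a) refl

-- ln x = ∫₁ˣ dt/t, as the limit of its Riemann sums.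
ln : (x : ℕ) .{{_ : ℕ.NonZero x}} → ℝ
ln x = mkℝ (lower (ℕ.pred x)) (lower-cauchy (ℕ.pred x))

{-# OPTIONS --safe #-}
-- Universal graph: take the vertices (i , j) with (i + 1)(j + 1) ≤ n and i < k,
-- two of them adjacent when they have the same j.  A disjoint union of cliques
-- on at most n vertices embeds: list the cliques by decreasing size, counting
-- from 0; if the j-th one has more than i vertices, then so do its predecessors,
-- whence (i + 1)(j + 1) ≤ n.
--
-- Minimality: for i = 1, …, k pick in turn an independent set of ⌊n/i⌋ vertices
-- that avoids the earlier ones, one vertex from each clique of a copy of
-- ⌊n/i⌋ · K_i.  Each of the i − 1 earlier independent sets meets a clique at
-- most once, so every clique of size i still has an unused vertex.
--
-- Logarithm: n + 1 ≤ i (⌊n/i⌋ + 1), so the sum is at least (n + 1) H_k − k, and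
-- H_k is an upper Riemann sum of ln (k + 1).
module Submission where

open import Defs
open import Data.Fin.Base as Fin using (Fin; zero; suc; toℕ; fromℕ<; inject₁; inject≤)
import Data.Fin.Properties as Fin
open import Data.Fin.Subset using (Subset; inside; outside; _∈_) renaming (∣_∣ to ∥_∥)
open import Data.Fin.Subset.Properties using (p⊂q⇒∣p∣<∣q∣; p⊆q⇒∣p∣≤∣q∣)
open import Data.Integer.Base as ℤ using (+_)
import Data.Integer.Properties as ℤ
open import Data.List.Base using (applyUpTo; tabulate; []; _∷_)
open import Data.List.Properties using (applyUpTo-∷ʳ)
open import Data.Nat.Base as ℕ using (ℕ; zero; suc; NonZero)
open import Data.Nat.DivMod using (m/n*n≤m; m*n/n≡m; /-monoˡ-≤; m%n<n; m≡m%n+[m/n]*n)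
open import Data.Nat.ListAction using (sum)
open import Data.Nat.ListAction.Properties using (sum-++)
import Data.Nat.Properties as ℕ
import Data.Nat.Solver as ℕ-Solver
open import Data.Product.Base using (Σ; Σ-syntax; ∃-syntax; _×_; _,_; proj₁; proj₂)
open import Data.Rational.Base as ℚ using (_/_; _≤_; 0ℚ)
import Data.Rational.Properties as ℚ
import Data.Rational.Solver as ℚ-Solver
import Data.Rational.Unnormalised.Base as ℚᵘ
import Data.Rational.Unnormalised.Properties as ℚᵘ
open import Data.Sum.Base using (_⊎_; inj₁; inj₂; [_,_]′)
open import Data.Sum.Function.Propositional using (_⊎-↔_)
import Data.Vec.Base as Vec
open import Data.Vec.Properties using ([]=⇒lookup; lookup⇒[]=; lookup∘tabulate)
open import Data.Vec.Properties.WithK using ([]=-irrelevant)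
open import Function.Base using (_∘_; _∘′_)
open import Function.Bundles using (_↔_; mk↔ₛ′; _⇔_; mk⇔; Inverse; Equivalence)
open import Function.Definitions using (Injective)
open import Function.Properties.Inverse using (↔-refl; ↔-sym; ↔-trans)
import Function.Properties.Equivalence as ⇔
open import Level using (0ℓ)
open import Relation.Binary.PropositionalEquality
  using (_≡_; _≢_; refl; sym; trans; cong; cong₂; subst; subst₂)
open import Relation.Nullary.Decidable using (Dec; yes; no; does; ¬?; _×-dec_; decidable-stable; dec-true)
open import Relation.Nullary.Negation using (¬_; contradiction)
open import Relation.Unary using (Pred; Decidable)

open Inverse using (to; from; strictlyInverseˡ; strictlyInverseʳ)

-- Bijections, decidable subsets and their sizes

to-injective : {A B : Set} (φ : A ↔ B) → Injective _≡_ _≡_ (to φ)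
to-injective φ {x} {y} eq =
  trans (sym (strictlyInverseʳ φ x)) (trans (cong (from φ) eq) (strictlyInverseʳ φ y))

module _ {n} {P : Pred (Fin n) 0ℓ} (P? : Decidable P) where

  comprehension : Subset n
  comprehension = Vec.tabulate (does ∘ P?)

  ∈-comprehension⁺ : ∀ {x} → P x → x ∈ comprehension
  ∈-comprehension⁺ {x} px = lookup⇒[]= x _ (trans (lookup∘tabulate _ x) (dec-true (P? x) px))

  ∈-comprehension⁻ : ∀ {x} → x ∈ comprehension → P x
  ∈-comprehension⁻ {x} x∈ with P? x | trans (sym (lookup∘tabulate (does ∘ P?) x)) ([]=⇒lookup x∈)
  ... | yes px | _ = px

∥∥*≤sum : ∀ {n} (p : Subset n) (a : Fin n → ℕ) c → (∀ {x} → x ∈ p → c ℕ.≤ a x) →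
          ∥ p ∥ ℕ.* c ℕ.≤ sum (tabulate a)
∥∥*≤sum Vec.[]              a c c≤a = ℕ.z≤n
∥∥*≤sum (outside Vec.∷ p) a c c≤a =
  ℕ.≤-trans (∥∥*≤sum p (a ∘ suc) c (c≤a ∘′ Vec.there)) (ℕ.m≤n+m _ (a zero))
∥∥*≤sum (inside  Vec.∷ p) a c c≤a =
  ℕ.+-mono-≤ (c≤a Vec.here) (∥∥*≤sum p (a ∘ suc) c (c≤a ∘′ Vec.there))

-- Ranking by decreasing value

module _ {r} (a : Fin r → ℕ) where

  -- Ties in a are broken by the index.
  key : Fin r → ℕ
  key x = a x ℕ.* r ℕ.+ toℕ x

  -- `key` orders the pairs (`a x`, `toℕ x`) lexicographically, because the second entry stays below
  -- `r`.
  key-cancel-≤ : ∀ {x y} → key x ℕ.≤ key y → a x ℕ.≤ a y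
  key-cancel-≤ {x} {y} kx≤ky = ℕ.≮⇒≥ λ ay<ax → ℕ.≤⇒≯ kx≤ky (begin-strict
    a y ℕ.* r ℕ.+ toℕ y   <⟨ ℕ.+-monoʳ-< (a y ℕ.* r) (Fin.toℕ<n y) ⟩
    a y ℕ.* r ℕ.+ r       ≡⟨ ℕ.+-comm (a y ℕ.* r) r ⟩
    suc (a y) ℕ.* r       ≤⟨ ℕ.*-monoˡ-≤ r ay<ax ⟩
    a x ℕ.* r             ≤⟨ ℕ.m≤m+n _ _ ⟩
    key x                 ∎)
    where open ℕ.≤-Reasoning

  key-injective : Injective _≡_ _≡_ key
  key-injective {x} {y} eq = Fin.toℕ-injective (ℕ.+-cancelˡ-≡ (a x ℕ.* r) _ _
    (trans eq (cong (λ b → b ℕ.* r ℕ.+ toℕ y) (sym ax≡ay))))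
    where
    ax≡ay : a x ≡ a y
    ax≡ay = ℕ.≤-antisym (key-cancel-≤ (ℕ.≤-reflexive eq)) (key-cancel-≤ (ℕ.≤-reflexive (sym eq)))

  above? : ∀ x → Decidable (λ y → key x ℕ.< key y)
  above? x y = key x ℕ.<? key y

  upwards? : ∀ x → Decidable (λ y → key x ℕ.≤ key y)
  upwards? x y = key x ℕ.≤? key y

  rank : Fin r → ℕ
  rank x = ∥ comprehension (above? x) ∥

  rank<∥upwards∥ : ∀ x → rank x ℕ.< ∥ comprehension (upwards? x) ∥
  rank<∥upwards∥ x = p⊂q⇒∣p∣<∣q∣
    ( (λ y∈ → ∈-comprehension⁺ (upwards? x) (ℕ.<⇒≤ (∈-comprehension⁻ (above? x) y∈)))
    , x , ∈-comprehension⁺ (upwards? x) ℕ.≤-refl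
    , λ x∈ → ℕ.<-irrefl refl (∈-comprehension⁻ (above? x) x∈))

  -- Everything weakly above `y` is strictly above `x`, and this already includes `y` itself, which
  -- `rank y` does not count.
  rank-anti : ∀ {x y} → key x ℕ.< key y → rank y ℕ.< rank x
  rank-anti {x} {y} kx<ky = ℕ.<-≤-trans (rank<∥upwards∥ y) (p⊆q⇒∣p∣≤∣q∣
    (λ z∈ → ∈-comprehension⁺ (above? x) (ℕ.<-≤-trans kx<ky (∈-comprehension⁻ (upwards? y) z∈))))

  rank-injective : Injective _≡_ _≡_ rank
  rank-injective {x} {y} eq = key-injective (ℕ.≤-antisym
    (ℕ.≮⇒≥ λ ky<kx → ℕ.<-irrefl eq (rank-anti ky<kx))
    (ℕ.≮⇒≥ λ kx<ky → ℕ.<-irrefl (sym eq) (rank-anti kx<ky)))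

  -- `x` and the indices that `rank x` counts each contribute at least `a x` to the sum.
  rank-*-≤sum : ∀ x → suc (rank x) ℕ.* a x ℕ.≤ sum (tabulate a)
  rank-*-≤sum x = ℕ.≤-trans (ℕ.*-monoˡ-≤ (a x) (rank<∥upwards∥ x))
    (∥∥*≤sum _ a (a x) (λ y∈ → key-cancel-≤ (∈-comprehension⁻ (upwards? x) y∈)))

-- Finite sums as cardinalities

ΣFin-suc : ∀ {r} {F : Fin (suc r) → Set} → Σ (Fin (suc r)) F ↔ (F zero ⊎ Σ (Fin r) (F ∘ suc))
ΣFin-suc = mk↔ₛ′
  (λ { (zero , x) → inj₁ x ; (suc i , x) → inj₂ (i , x) })
  [ (zero ,_) , (λ (i , x) → suc i , x) ]′
  (λ { (inj₁ _) → refl ; (inj₂ _) → refl })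
  (λ { (zero , _) → refl ; (suc _ , _) → refl })

ΣFin↔Fin-sum : ∀ {r} (a : Fin r → ℕ) → Σ (Fin r) (Fin ∘ a) ↔ Fin (sum (tabulate a))
ΣFin↔Fin-sum {zero}  a = mk↔ₛ′ (λ ()) (λ ()) (λ ()) (λ ())
ΣFin↔Fin-sum {suc r} a =
  ↔-trans ΣFin-suc (↔-trans (↔-refl ⊎-↔ ΣFin↔Fin-sum (a ∘ suc)) (↔-sym Fin.+↔⊎))

applyUpTo≡tabulate : ∀ (f : ℕ → ℕ) k → applyUpTo f k ≡ tabulate {n = k} (f ∘ toℕ)
applyUpTo≡tabulate f zero    = refl
applyUpTo≡tabulate f (suc k) = cong (f 0 ∷_) (applyUpTo≡tabulate (f ∘ suc) k)

sum-applyUpTo-suc : ∀ f k → sum (applyUpTo f (suc k)) ≡ sum (applyUpTo f k) ℕ.+ f k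
sum-applyUpTo-suc f k = trans (cong sum (sym (applyUpTo-∷ʳ f k)))
  (trans (sum-++ (applyUpTo f k) (f k ∷ [])) (cong (sum (applyUpTo f k) ℕ.+_) (ℕ.+-identityʳ (f k))))

-- Embeddings of graphs as induced subgraphs

record _↪_ {V W : Set} (G : SimpleGraph V) (H : SimpleGraph W) : Set where
  field
    map       : V → W
    injective : Injective _≡_ _≡_ map
    map-adj⇔  : ∀ x y → Adj G x y ⇔ Adj H (map x) (map y)

open _↪_

↪-trans : ∀ {U V W : Set} {F : SimpleGraph U} {G : SimpleGraph V} {H : SimpleGraph W} →
          F ↪ G → G ↪ H → F ↪ H
↪-trans e e′ = record
  { map       = map e′ ∘ map e
  ; injective = injective e ∘ injective e′
  ; map-adj⇔  = λ x y → ⇔.trans (map-adj⇔ e x y) (map-adj⇔ e′ (map e x) (map e y))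
  }

≅⇒↪ : ∀ {V W : Set} {G : SimpleGraph V} {H : SimpleGraph W} → G ≅ H → G ↪ H
≅⇒↪ φ = record
  { map       = to (_≅_.vertices φ)
  ; injective = to-injective (_≅_.vertices φ)
  ; map-adj⇔  = _≅_.adj⇔ φ
  }

induced↪ : ∀ {N} (U : SimpleGraph (Fin N)) (S : Subset N) → induced U S ↪ U
induced↪ U S = record
  { map       = proj₁
  -- Membership proofs are unique, so the first component determines the vertex.
  ; injective = λ { {x , x∈} {.x , x∈′} refl → cong (x ,_) ([]=-irrelevant x∈ x∈′) }
  ; map-adj⇔  = λ _ _ → ⇔.refl
  }

-- Allows universality to be checked with embeddings, which compose without transporting subsets.
-- The subset is the image; its membership witnesses provide the inverse map.
↪⇒≅induced : ∀ {m N} {G : SimpleGraph (Fin m)} {U : SimpleGraph (Fin N)} →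
             G ↪ U → Σ[ S ∈ Subset N ] G ≅ induced U S
↪⇒≅induced {N = N} {G} {U} e = image , record
  { vertices = mk↔ₛ′
      (λ x → map e x , ∈-comprehension⁺ image? (x , refl))
      (λ (v , v∈) → proj₁ (∈-comprehension⁻ image? v∈))
      (λ (v , v∈) → injective (induced↪ U image) (proj₂ (∈-comprehension⁻ image? v∈)))
      (λ x → injective e (proj₂ (∈-comprehension⁻ image? (∈-comprehension⁺ image? (x , refl)))))
  ; adj⇔ = map-adj⇔ e
  }
  where
  image? : Decidable (λ v → ∃[ x ] map e x ≡ v)
  image? v = Fin.any? (λ x → map e x Fin.≟ v)
  image : Subset N
  image = comprehension image?

relabel : ∀ {V W : Set} → V ↔ W → SimpleGraph W → SimpleGraph V
relabel φ G = record
  { Adj     = λ x y → Adj G (to φ x) (to φ y)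
  ; adj?    = λ x y → adj? G (to φ x) (to φ y)
  ; sym-adj = sym-adj G
  ; irrefl  = λ x≡y → irrefl G (cong (to φ) x≡y)
  }

relabel-≅ : ∀ {V W : Set} (φ : V ↔ W) (G : SimpleGraph W) → relabel φ G ≅ G
relabel-≅ φ G = record { vertices = φ ; adj⇔ = λ _ _ → ⇔.refl }

↪-relabel : ∀ {V W : Set} (φ : V ↔ W) (G : SimpleGraph W) → G ↪ relabel φ G
↪-relabel φ G = record
  { map       = from φ
  ; injective = to-injective (↔-sym φ)
  ; map-adj⇔  = λ x y → subst₂ (λ x′ y′ → Adj G x y ⇔ Adj G x′ y′)
                  (sym (strictlyInverseˡ φ x)) (sym (strictlyInverseˡ φ y)) ⇔.refl
  }

-- The universal graph

m*o≤n⇒m≤n/o : ∀ m n o .{{_ : NonZero o}} → m ℕ.* o ℕ.≤ n → m ℕ.≤ n ℕ./ o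
m*o≤n⇒m≤n/o m n o m*o≤n = subst (ℕ._≤ n ℕ./ o) (m*n/n≡m m o) (/-monoˡ-≤ o m*o≤n)

module _ (n k : ℕ) where

  -- The bound j < ⌊n/(i + 1)⌋ is (i + 1)(j + 1) ≤ n; grouping the pairs by i makes their number the
  -- floor sum.
  Hyperbola : Set
  Hyperbola = Σ[ i ∈ Fin k ] Fin (n ℕ./ suc (toℕ i))

  hyperbola : SimpleGraph Hyperbola
  hyperbola = record
    -- `j` and `j′` lie in different `Fin` types, hence the comparison through `toℕ`.
    { Adj     = λ (i , j) (i′ , j′) → toℕ j ≡ toℕ j′ × i ≢ i′
    ; adj?    = λ (i , j) (i′ , j′) → (toℕ j ℕ.≟ toℕ j′) ×-dec ¬? (i Fin.≟ i′)
    ; sym-adj = λ (j≡ , i≢) → sym j≡ , i≢ ∘ sym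
    ; irrefl  = λ { refl (_ , i≢i) → i≢i refl }
    }

  Fin-floorSum↔Hyperbola : Fin (floorSum n k) ↔ Hyperbola
  Fin-floorSum↔Hyperbola = subst (λ l → Fin (sum l) ↔ Hyperbola)
    (sym (applyUpTo≡tabulate (λ i → n ℕ./ suc i) k)) (↔-sym (ΣFin↔Fin-sum _))

  ⨆complete↪hyperbola : ∀ {r} (a : Fin r → ℕ) → (∀ i → a i ℕ.≤ k) → sum (tabulate a) ℕ.≤ n →
                        ⨆ (complete ∘ a) ↪ hyperbola
  ⨆complete↪hyperbola {r} a a≤k ∑a≤n = record
    { map       = place
    ; injective = place-injective
    ; map-adj⇔  = λ x y → mk⇔ adj⁺ adj⁻
    }
    where
    -- The row of clique `t` is long enough for its vertex `s`: the cliques ranked up to `t` have at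
    -- least `suc (rank a t) * a t` vertices in total, and `s < a t`.
    rank< : ∀ t (s : Fin (a t)) → rank a t ℕ.< n ℕ./ suc (toℕ (inject≤ s (a≤k t)))
    rank< t s = m*o≤n⇒m≤n/o (suc (rank a t)) n _ (begin
      suc (rank a t) ℕ.* suc (toℕ (inject≤ s (a≤k t)))
        ≡⟨ cong (λ i → suc (rank a t) ℕ.* suc i) (Fin.toℕ-inject≤ s (a≤k t)) ⟩
      suc (rank a t) ℕ.* suc (toℕ s)  ≤⟨ ℕ.*-monoʳ-≤ (suc (rank a t)) (Fin.toℕ<n s) ⟩
      suc (rank a t) ℕ.* a t          ≤⟨ rank-*-≤sum a t ⟩
      sum (tabulate a)                ≤⟨ ∑a≤n ⟩
      n                               ∎)
      where open ℕ.≤-Reasoning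

    place : Σ (Fin r) (Fin ∘ a) → Hyperbola
    place (t , s) = inject≤ s (a≤k t) , fromℕ< (rank< t s)

    -- The row is the rank, and even cliques of equal size have distinct ranks.
    same-clique : ∀ {t t′ s s′} → toℕ (proj₂ (place (t , s))) ≡ toℕ (proj₂ (place (t′ , s′))) → t ≡ t′
    same-clique {t} {t′} {s} {s′} eq = rank-injective a
      (trans (sym (Fin.toℕ-fromℕ< (rank< t s))) (trans eq (Fin.toℕ-fromℕ< (rank< t′ s′))))

    place-injective : Injective _≡_ _≡_ place
    place-injective {t , s} {t′ , s′} eq with same-clique {t} {t′} {s} {s′} (cong (toℕ ∘ proj₂) eq)
    ... | refl = cong (t ,_) (Fin.inject≤-injective (a≤k t) (a≤k t) s s′ (cong proj₁ eq))

    adj⁺ : ∀ {x y} → ⨆-Adj (complete ∘ a) x y → Adj hyperbola (place x) (place y)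
    adj⁺ (within {t} {s} {s′} s≢s′) =
        trans (Fin.toℕ-fromℕ< (rank< t s)) (sym (Fin.toℕ-fromℕ< (rank< t s′)))
      , s≢s′ ∘ Fin.inject≤-injective (a≤k t) (a≤k t) s s′

    adj⁻ : ∀ {x y} → Adj hyperbola (place x) (place y) → ⨆-Adj (complete ∘ a) x y
    adj⁻ {t , s} {t′ , s′} (j≡j′ , i≢i′) with same-clique {t} {t′} {s} {s′} j≡j′
    ... | refl = within λ s≡s′ → i≢i′ (cong (λ s → inject≤ s (a≤k t)) s≡s′)

  hyperbola-universal : IsInducedUniversal (𝒦 n k) (relabel Fin-floorSum↔Hyperbola hyperbola)
  hyperbola-universal m G (m≤n , r , a , a≤k , G≅) = ↪⇒≅induced
    (↪-trans (≅⇒↪ G≅) (↪-trans (⨆complete↪hyperbola a a≤k (ℕ.≤-trans ∑a≤m m≤n))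
      (↪-relabel Fin-floorSum↔Hyperbola hyperbola)))
    where
    ∑a≤m : sum (tabulate a) ℕ.≤ m
    ∑a≤m = Fin.injective⇒≤
      (to-injective (↔-trans (↔-sym (ΣFin↔Fin-sum a)) (↔-sym (_≅_.vertices G≅))))

-- Minimality

module _ {M} (U : SimpleGraph (Fin M)) where

  -- The colour classes are the independent sets picked so far.
  record Coloured (A : Set) (j : ℕ) : Set where
    field
      vertex           : A → Fin M
      vertex-injective : Injective _≡_ _≡_ vertex
      colour           : A → Fin j
      independent      : ∀ {x y} → colour x ≡ colour y → ¬ Adj U (vertex x) (vertex y)

  coloured-relabel : ∀ {A B j} → A ↔ B → Coloured B j → Coloured A j
  coloured-relabel φ C = record
    { vertex           = vertex ∘ to φ
    ; vertex-injective = to-injective φ ∘ vertex-injective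
    ; colour           = colour ∘ to φ
    ; independent      = independent
    }
    where open Coloured C

  module _ {N j r} (C : Coloured (Fin N) j) (e : ⨆ {r} (λ _ → complete (suc j)) ↪ U) where
    open Coloured C

    used? : ∀ v → Dec (∃[ x ] vertex x ≡ v)
    used? v = Fin.any? (λ x → vertex x Fin.≟ v)

    -- If all `suc j` vertices of the clique were used, two of them would share one of the `j`
    -- colours by the pigeonhole principle, yet they are adjacent.
    unused : ∀ t → ∃[ s ] ¬ (∃[ x ] vertex x ≡ map e (t , s))
    unused t with Fin.any? (λ s → ¬? (used? (map e (t , s))))
    ... | yes p = p
    ... | no ¬p = contradiction adjacent (independent same-colour)
      where
      all-used : ∀ s → ∃[ x ] vertex x ≡ map e (t , s)
      all-used s = decidable-stable (used? (map e (t , s))) (λ ¬used → ¬p (s , ¬used))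
      ph = Fin.pigeonhole (ℕ.n<1+n j) (colour ∘ proj₁ ∘ all-used)
      s₁ = proj₁ ph
      s₂ = proj₁ (proj₂ ph)
      same-colour : colour (proj₁ (all-used s₁)) ≡ colour (proj₁ (all-used s₂))
      same-colour = proj₂ (proj₂ (proj₂ ph))
      adjacent : Adj U (vertex (proj₁ (all-used s₁))) (vertex (proj₁ (all-used s₂)))
      adjacent = subst₂ (Adj U) (sym (proj₂ (all-used s₁))) (sym (proj₂ (all-used s₂)))
        (Equivalence.to (map-adj⇔ e _ _) (within (Fin.<⇒≢ (proj₁ (proj₂ (proj₂ ph))))))

    fresh : Fin r → Fin M
    fresh t = map e (t , proj₁ (unused t))

    fresh≢vertex : ∀ x t → vertex x ≢ fresh t
    fresh≢vertex x t eq = proj₂ (unused t) (x , eq)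

    -- Adjacency reflects back to the disjoint union, where it stays inside one clique, and each
    -- clique supplies a single fresh vertex.
    fresh-independent : ∀ t t′ → ¬ Adj U (fresh t) (fresh t′)
    fresh-independent t t′ adj with Equivalence.from (map-adj⇔ e _ _) adj
    ... | within s≢s = s≢s refl

    coloured-extend : Coloured (Fin N ⊎ Fin r) (suc j)
    coloured-extend = record
      { vertex           = [ vertex , fresh ]′
      ; vertex-injective = λ
        { {inj₁ x} {inj₁ y} eq → cong inj₁ (vertex-injective eq)
        ; {inj₁ x} {inj₂ t} eq → contradiction eq (fresh≢vertex x t)
        ; {inj₂ t} {inj₁ x} eq → contradiction (sym eq) (fresh≢vertex x t)
        ; {inj₂ t} {inj₂ u} eq → cong (inj₂ ∘ proj₁) (injective e eq)
        }
      -- All fresh vertices receive the new top colour; the old colours are kept below it.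
      ; colour           = [ inject₁ ∘ colour , (λ _ → Fin.fromℕ j) ]′
      ; independent      = λ
        { {inj₁ x} {inj₁ y} eq → independent (Fin.inject₁-injective eq)
        ; {inj₁ x} {inj₂ t} eq → contradiction (sym eq) Fin.fromℕ≢inject₁
        ; {inj₂ t} {inj₁ x} eq → contradiction eq Fin.fromℕ≢inject₁
        ; {inj₂ t} {inj₂ u} _  → fresh-independent t u
        }
      }

  -- Induction on the clique size. At `j = k` the injectivity of `vertex` bounds `M` from below.
  coloured-floorSum : ∀ n k → IsInducedUniversal (𝒦 n k) U →
                      ∀ j → j ℕ.≤ k → Coloured (Fin (floorSum n j)) j
  coloured-floorSum n k univ zero    _   = record
    { vertex           = λ ()
    ; vertex-injective = λ { {()} }
    ; colour           = λ ()
    ; independent      = λ { {()} }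
    }
  coloured-floorSum n k univ (suc j) j<k =
    subst (λ N → Coloured (Fin N) (suc j)) (sym (sum-applyUpTo-suc (λ i → n ℕ./ suc i) j))
      (coloured-relabel Fin.+↔⊎
        (coloured-extend (coloured-floorSum n k univ j (ℕ.<⇒≤ j<k)) cliques↪U))
    where
    r = n ℕ./ suc j
    cliques : SimpleGraph (Fin r × Fin (suc j))
    cliques = ⨆ (λ _ → complete (suc j))
    -- By the choice of `r` the cliques have at most `n` vertices in total, and `suc j ≤ k`, so `U`
    -- contains a copy.
    copy = univ (r ℕ.* suc j) (relabel Fin.*↔× cliques)
      (m/n*n≤m n (suc j) , r , (λ _ → suc j) , (λ _ → j<k) , relabel-≅ Fin.*↔× cliques)
    cliques↪U : cliques ↪ U
    cliques↪U = ↪-trans (↪-relabel Fin.*↔× cliques)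
      (↪-trans (≅⇒↪ (proj₂ copy)) (induced↪ U (proj₁ copy)))

  floorSum≤ : ∀ n k → IsInducedUniversal (𝒦 n k) U → floorSum n k ℕ.≤ M
  floorSum≤ n k univ = Fin.injective⇒≤ (Coloured.vertex-injective (coloured-floorSum n k univ k ℕ.≤-refl))

-- The logarithmic bound

/1-homo-+ : ∀ m n → + (m ℕ.+ n) / 1 ≡ + m / 1 ℚ.+ + n / 1
/1-homo-+ m n = ℚ.toℚᵘ-injective
  (ℚᵘ.≃-trans (ℚ.toℚᵘ-fromℚᵘ (ℚᵘ.mkℚᵘ (+ (m ℕ.+ n)) 0))
  (ℚᵘ.≃-trans (ℚᵘ.*≡* (cong (ℤ._* + 1)
     (sym (cong₂ ℤ._+_ (ℤ.*-identityʳ (+ m)) (ℤ.*-identityʳ (+ n))))))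
  (ℚᵘ.≃-sym (ℚᵘ.≃-trans (ℚ.toℚᵘ-homo-+ (+ m / 1) (+ n / 1))
    (ℚᵘ.+-cong (ℚ.toℚᵘ-fromℚᵘ (ℚᵘ.mkℚᵘ (+ m) 0)) (ℚ.toℚᵘ-fromℚᵘ (ℚᵘ.mkℚᵘ (+ n) 0)))))))

/1-*-recip-≤ : ∀ {a b d} → a ℕ.≤ b ℕ.* suc d → + a / 1 ℚ.* recip d ≤ + b / 1
/1-*-recip-≤ {a} {b} {d} a≤b*d = ℚ.toℚᵘ-cancel-≤
  (ℚᵘ.≤-respˡ-≃ (ℚᵘ.≃-sym (ℚᵘ.≃-trans (ℚ.toℚᵘ-homo-* (+ a / 1) (recip d))
    (ℚᵘ.*-cong (ℚ.toℚᵘ-fromℚᵘ (ℚᵘ.mkℚᵘ (+ a) 0)) (ℚ.toℚᵘ-fromℚᵘ (ℚᵘ.mkℚᵘ (+ 1) d)))))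
  (ℚᵘ.≤-respʳ-≃ (ℚᵘ.≃-sym (ℚ.toℚᵘ-fromℚᵘ (ℚᵘ.mkℚᵘ (+ b) 0)))
  (ℚᵘ.*≤* (subst₂ ℤ._≤_ (sym lhs) (sym rhs) (ℤ.+≤+ a≤b*d)))))
  where
  lhs : + a ℤ.* + 1 ℤ.* + 1 ≡ + a
  lhs = trans (ℤ.*-identityʳ (+ a ℤ.* + 1)) (ℤ.*-identityʳ (+ a))
  rhs : + b ℤ.* + (1 ℕ.* suc d) ≡ + (b ℕ.* suc d)
  rhs = trans (cong (λ z → + b ℤ.* + z) (ℕ.*-identityˡ (suc d))) (sym (ℤ.pos-* b (suc d)))

-- The remainder is strictly less than `d`; this strictness yields the factor n + 1 instead of n in
-- the logarithmic bound.
n<1+n/d*d : ∀ n d .{{_ : NonZero d}} → suc n ℕ.≤ suc (n ℕ./ d) ℕ.* d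
n<1+n/d*d n d = begin-strict
  n                              ≡⟨ m≡m%n+[m/n]*n n d ⟩
  n ℕ.% d ℕ.+ n ℕ./ d ℕ.* d     <⟨ ℕ.+-monoˡ-< (n ℕ./ d ℕ.* d) (m%n<n n d) ⟩
  suc (n ℕ./ d) ℕ.* d            ∎
  where open ℕ.≤-Reasoning

-- Sums (n + 1)/i ≤ ⌊n/i⌋ + 1 over i = 1, ..., k; the units add up to the final `k`.
harmonic-bound : ∀ n k → + suc n / 1 ℚ.* ∑< k recip ≤ + floorSum n k / 1 ℚ.+ + k / 1
harmonic-bound n zero    = ℚ.≤-reflexive (ℚ.*-zeroʳ (+ suc n / 1))
harmonic-bound n (suc k) = begin
  c ℚ.* (∑< k recip ℚ.+ recip k)            ≡⟨ ℚ.*-distribˡ-+ c (∑< k recip) (recip k) ⟩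
  c ℚ.* ∑< k recip ℚ.+ c ℚ.* recip k
    ≤⟨ ℚ.+-mono-≤ (harmonic-bound n k) (/1-*-recip-≤ {suc n} {suc q} {k} (n<1+n/d*d n (suc k))) ⟩
  + floorSum n k / 1 ℚ.+ + k / 1 ℚ.+ + suc q / 1
    ≡⟨ sym (trans (/1-homo-+ (floorSum n k ℕ.+ k) (suc q))
         (cong (ℚ._+ + suc q / 1) (/1-homo-+ (floorSum n k) k))) ⟩
  + (floorSum n k ℕ.+ k ℕ.+ suc q) / 1      ≡⟨ cong (λ z → + z / 1) regroup ⟩
  + (floorSum n (suc k) ℕ.+ suc k) / 1      ≡⟨ /1-homo-+ (floorSum n (suc k)) (suc k) ⟩
  + floorSum n (suc k) / 1 ℚ.+ + suc k / 1  ∎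
  where
  open ℚ.≤-Reasoning
  c = + suc n / 1
  q = n ℕ./ suc k
  regroup : floorSum n k ℕ.+ k ℕ.+ suc q ≡ floorSum n (suc k) ℕ.+ suc k
  regroup = trans (solve 3 (λ f k q → f :+ k :+ (con 1 :+ q) := f :+ q :+ (con 1 :+ k)) refl
                     (floorSum n k) k q)
    (cong (ℕ._+ suc k) (sym (sum-applyUpTo-suc (λ i → n ℕ./ suc i) k)))
    where open ℕ-Solver.+-*-Solver

-- The harmonic number is `upper k 0`, the left-endpoint sum of mesh 1, up to its length `k * 1`.
lower≤harmonic : ∀ k m → lower k (suc m) ≤ ∑< k recip
lower≤harmonic k m =
  subst (λ N → lower k (suc m) ≤ ∑< N recip) (ℕ.*-identityʳ k) (lower≤upper′ k m 0)

log-bound : ∀ n k → fromℕ (floorSum n k) ≥ᴿ (+ suc n / 1) ·ᴿ ln (suc k) -ᴿ fromℕ k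
-- Every term from index 1 on satisfies the bound even without `ε`; index 0, an empty Riemann sum,
-- is skipped.
log-bound n k ε 0<ε = 1 , bound
  where
  c = + suc n / 1
  F = + floorSum n k / 1
  K = + k / 1
  bound : ∀ m → 1 ℕ.≤ m → c ℚ.* lower k m ℚ.- K ≤ F ℚ.+ ε
  bound (suc m) _ = begin
    c ℚ.* lower k (suc m) ℚ.- K
      ≤⟨ ℚ.+-monoˡ-≤ (ℚ.- K) (ℚ.*-monoˡ-≤-nonNeg c {{ℚ.normalize-nonNeg (suc n) 1}} (lower≤harmonic k m)) ⟩
    c ℚ.* ∑< k recip ℚ.- K   ≤⟨ ℚ.+-monoˡ-≤ (ℚ.- K) (harmonic-bound n k) ⟩
    F ℚ.+ K ℚ.- K            ≡⟨ solve 2 (λ x y → x :+ y :- y := x :+ con 0ℚ) refl F K ⟩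
    F ℚ.+ 0ℚ                 ≤⟨ ℚ.+-monoʳ-≤ F (ℚ.<⇒≤ 0<ε) ⟩
    F ℚ.+ ε                  ∎
    where
    open ℚ.≤-Reasoning
    open ℚ-Solver.+-*-Solver

theorem1 : (n k : ℕ) .{{_ : NonZero n}} .{{_ : NonZero k}} →
    (𝒰 𝒦 n k ≔ floorSum n k) ×
    (fromℕ (floorSum n k) ≥ᴿ (+ suc n / 1) ·ᴿ ln (suc k) -ᴿ fromℕ k)
theorem1 n k = record
  { attained = relabel (Fin-floorSum↔Hyperbola n k) (hyperbola n k) , hyperbola-universal n k
  ; minimal  = λ M U → floorSum≤ U n k
  } , log-bound n k
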